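{- Let $G$ be a finite simple graph with exactly two holes. Then the competition number of $G$ satisfies $k(G) \le 3$.
   Context: For an acyclic digraph $D$, the competition graph $C(D)$ is the graph with vertex set $V(D)$ in which distinct vertices $x,y$ are adjacent if and only if there is a vertex $v$ with $(x,v)$ and $(y,v)$ both arcs of $D$. For a graph $G$, the competition number $k(G)$ is the smallest nonnegative integer $k$ such that $G$ together with $k$ new isolated vertices is the competition graph of some acyclic digraph. A hole of a graph is an induced subgraph that is a cycle of length at least $4$. -}

module Defs where

open import Data.Nat using (ℕ; zero; suc; _+_; _≤_; _%_)
open import Data.Fin using (Fin; toℕ; _↑ˡ_; _↑ʳ_; splitAt)
open import Data.Fin.Subset using (Subset; _∈_)
open import Data.Bool using (Bool; true; false)
open import Data.Sum using (_⊎_; inj₁; inj₂)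
open import Data.Product using (Σ; _×_; ∃; _,_)
open import Relation.Binary.PropositionalEquality using (_≡_; _≢_)
open import Relation.Nullary using (¬_)
open import Function.Definitions using (Injective)

_⇔′_ : Set → Set → Set
A ⇔′ B = (A → B) × (B → A)

record Graph (n : ℕ) : Set where
  field
    adj   : Fin n → Fin n → Bool
    sym   : ∀ x y → adj x y ≡ adj y x
    irrefl : ∀ x → adj x x ≡ false
open Graph public

record Digraph (m : ℕ) : Set where
  field
    arc : Fin m → Fin m → Bool
open Digraph public

data Path⁺ {m : ℕ} (D : Digraph m) : Fin m → Fin m → Set where
  step : ∀ {x y} → arc D x y ≡ true → Path⁺ D x y
  cons : ∀ {x y z} → arc D x y ≡ true → Path⁺ D y z → Path⁺ D x z

Acyclic : ∀ {m} → Digraph m → Set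
Acyclic D = ∀ v → ¬ Path⁺ D v v

IsCompetitionGraphOf : ∀ {m} → Graph m → Digraph m → Set
IsCompetitionGraphOf {m} G D =
  ∀ (x y : Fin m) → x ≢ y →
    (adj G x y ≡ true) ⇔′ (Σ (Fin m) λ v → (arc D x v ≡ true) × (arc D y v ≡ true))

adjIso : ∀ {n} → Graph n → (k : ℕ) → Fin (n + k) → Fin (n + k) → Bool
adjIso {n} G k x y with splitAt n x | splitAt n y
... | inj₁ a | inj₁ b = adj G a b
... | inj₁ _ | inj₂ _ = false
... | inj₂ _ | _      = false

private
  adjIso-sym : ∀ {n} (G : Graph n) k x y → adjIso G k x y ≡ adjIso G k y x
  adjIso-sym {n} G k x y with splitAt n x | splitAt n y
  ... | inj₁ a | inj₁ b = sym G a b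
  ... | inj₁ _ | inj₂ _ = _≡_.refl
  ... | inj₂ _ | inj₁ _ = _≡_.refl
  ... | inj₂ _ | inj₂ _ = _≡_.refl

  adjIso-irrefl : ∀ {n} (G : Graph n) k x → adjIso G k x x ≡ false
  adjIso-irrefl {n} G k x with splitAt n x
  ... | inj₁ a = irrefl G a
  ... | inj₂ _ = _≡_.refl

addIsolated : ∀ {n} → Graph n → (k : ℕ) → Graph (n + k)
addIsolated G k = record { adj = adjIso G k ; sym = adjIso-sym G k ; irrefl = adjIso-irrefl G k }

CompetitionWith : ∀ {n} → Graph n → ℕ → Set
CompetitionWith {n} G k =
  Σ (Digraph (n + k)) λ D → Acyclic D × IsCompetitionGraphOf (addIsolated G k) D

-- k(G) ≤ b, unfolding k(G) = min { k | CompetitionWith G k }.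
CompetitionNumber≤ : ∀ {n} → Graph n → ℕ → Set
CompetitionNumber≤ G b = Σ ℕ λ k → k ≤ b × CompetitionWith G k

CycAdj : (l : ℕ) → Fin (4 + l) → Fin (4 + l) → Set
CycAdj l i j = (suc (toℕ i) % (4 + l) ≡ toℕ j) ⊎ (suc (toℕ j) % (4 + l) ≡ toℕ i)

-- S is (the vertex set of) a hole: the induced subgraph on S is a cycle of length ≥ 4.
IsHole : ∀ {n} → Graph n → Subset n → Set
IsHole {n} G S =
  Σ ℕ λ l → Σ (Fin (4 + l) → Fin n) λ f →
    Injective _≡_ _≡_ f
    × (∀ i j → (adj G (f i) (f j) ≡ true) ⇔′ CycAdj l i j)
    × (∀ v → (v ∈ S) ⇔′ (Σ (Fin (4 + l)) λ i → f i ≡ v))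

ExactlyTwoHoles : ∀ {n} → Graph n → Set
ExactlyTwoHoles {n} G =
  Σ (Subset n) λ S₁ → Σ (Subset n) λ S₂ →
    S₁ ≢ S₂ × IsHole G S₁ × IsHole G S₂
    × (∀ S → IsHole G S → (S ≡ S₁) ⊎ (S ≡ S₂))

{-# OPTIONS --safe #-}
module Submission where

-- A graph all of whose holes occur in a list L has competition number at most 1 + |L|.
-- Every nonempty graph has an avoidable vertex v: any two nonadjacent neighbours x, y of v
-- lie on a hole S through v with S ∩ N(v) = {x, y}.  (If C is connected and maximal with
-- R = V ∖ N[C] nonempty, then N(C) is completely joined to R, so an avoidable vertex of
-- G[R] is avoidable in G: nonadjacent neighbours in N(C) are linked through C.)
-- Choosing one neighbour of v on each of the m holes through v, the unchosen neighbours form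
-- a clique, so 1 + m cliques cover the edges at v.  Deleting v destroys those m holes and
-- makes v available as the common prey of one further clique, which closes the induction.

open import Defs
open import Data.Bool using (Bool; true; false) renaming (_≟_ to _≟ᵇ_)
open import Data.Empty using (⊥)
open import Data.Fin using (Fin; zero; suc; toℕ; splitAt; join) renaming (_≟_ to _≟ᶠ_)
open import Data.Fin.Properties using (any?; toℕ<n; join-splitAt; splitAt-join)
open import Data.Fin.Subset using (Subset; _∈_; _∉_; _⊆_; _⊂_; _∪_; _-_; ⁅_⁆; Nonempty) renaming (⊤ to full)
open import Data.Fin.Subset.Induction using (Acc; acc; ⊂-wellFounded; ⊃-wellFounded)
open import Data.Fin.Subset.Properties using (_∈?_; nonempty?; ∈⊤; x∈⁅x⁆; x∈⁅y⁆⇒x≡y; x∈p∪q⁺; x∈p∪q⁻; x∈p∧x≢y⇒x∈p-y; x∈p⇒p-x⊂p; ⊂-irref; p─q⊆p; p─q─q≡p─q)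
open import Data.List using (List; []; _∷_; length; lookup; filter; map; allFin)
open import Data.List.Membership.Propositional using () renaming (_∈_ to _∈ˡ_)
open import Data.List.Membership.Propositional.Properties using (∈-lookup; ∈-filter⁺)
open import Data.List.Properties using (length-map; length-tabulate)
open import Data.List.Relation.Unary.All as All using (All; []; _∷_)
open import Data.List.Relation.Unary.All.Properties using (¬Any⇒All¬) renaming (map⁺ to All-map⁺)
open import Data.List.Relation.Unary.AllPairs using ([]; _∷_)
open import Data.List.Relation.Unary.Any using (Any; here; there) renaming (any? to anyˡ?)
open import Data.List.Relation.Unary.Unique.Propositional using (Unique)
open import Data.List.Relation.Unary.Unique.Propositional.Properties using (allFin⁺) renaming (map⁺ to Unique-map⁺)
open import Data.Nat using (ℕ; zero; suc; _+_; _<_; _%_; z<s; s<s)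
open import Data.Nat.DivMod using (m<n⇒m%n≡m; n%n≡0)
open import Data.Nat.Properties using (suc-injective; +-suc; m≤n⇒m<n∨m≡n; ≤-refl; <-trans; <-irrefl)
open import Data.Product using (∃; _×_; _,_; proj₁; proj₂; swap)
open import Data.Sum as Sum using (_⊎_; inj₁; inj₂)
open import Data.Sum.Properties using (inj₂-injective) renaming (≡-dec to ≡-dec-⊎)
open import Data.Unit using (⊤; tt)
open import Data.Vec using (tabulate)
open import Data.Vec.Properties using (lookup∘tabulate; lookup⇒[]=; []=⇒lookup)
open import Function using (_∘_; id)
open import Function.Definitions using (Injective)
open import Relation.Binary.Construct.Closure.ReflexiveTransitive as Star using (Star; ε; _◅_; _◅◅_)
open import Relation.Binary.PropositionalEquality using (_≡_; _≢_; refl; trans; cong; subst) renaming (sym to ≡-sym)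
open import Relation.Nullary using (¬_; Dec; yes; no; does; ¬?; contradiction)
open import Relation.Nullary.Decidable using (dec-true; _×-dec_; _⊎-dec_; decidable-stable)

-- Decidable subsets, list splitting and cyclic successors

does-true : ∀ {P : Set} (d : Dec P) → does d ≡ true → P
does-true (yes p) _ = p

module _ {n : ℕ} {P : Fin n → Set} (P? : ∀ x → Dec (P x)) where

  comprehension : Subset n
  comprehension = tabulate (λ x → does (P? x))

  ∈-comprehension⁺ : ∀ {x} → P x → x ∈ comprehension
  ∈-comprehension⁺ {x} px = lookup⇒[]= x _ (trans (lookup∘tabulate _ x) (dec-true (P? x) px))

  ∈-comprehension⁻ : ∀ {x} → x ∈ comprehension → P x
  ∈-comprehension⁻ {x} x∈ = does-true (P? x) (trans (≡-sym (lookup∘tabulate _ x)) ([]=⇒lookup x∈))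

x∈p-y⇒x≢y : ∀ {n} {p : Subset n} {x y} → x ∈ p - y → x ≢ y
x∈p-y⇒x≢y {p = p} {y = y} y∈ refl = ⊂-irref (p─q─q≡p─q p ⁅ y ⁆) (x∈p⇒p-x⊂p y∈)

length-filter-∁ : ∀ {A : Set} {P : A → Set} (P? : ∀ x → Dec (P x)) xs →
  length (filter P? xs) + length (filter (¬? ∘ P?) xs) ≡ length xs
length-filter-∁ P? [] = refl
length-filter-∁ P? (x ∷ xs) with P? x
... | yes _ = cong suc (length-filter-∁ P? xs)
... | no  _ = trans (+-suc _ _) (cong suc (length-filter-∁ P? xs))

-- Separates the last index, whose cyclic successor is `0`, from the others, where `%` acts
-- trivially; adjacency on the cycle then reduces to adjacency on a path.
suc-mod : ∀ {l} (i : Fin (suc l)) →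
  (suc (toℕ i) ≡ suc l × suc (toℕ i) % suc l ≡ 0) ⊎
  (suc (toℕ i) % suc l ≡ suc (toℕ i) × suc (toℕ i) ≢ suc l)
suc-mod {l} i with m≤n⇒m<n∨m≡n (toℕ<n i)
... | inj₁ i<l = inj₂ (m<n⇒m%n≡m i<l , λ eq → <-irrefl eq i<l)
... | inj₂ i≡l = inj₁ (i≡l , trans (cong (_% suc l) i≡l) (n%n≡0 (suc l)))

-- Induced paths and closing them into holes

module _ {n : ℕ} (G : Graph n) where

  infix 4 _~_ _~?_

  _~_ : Fin n → Fin n → Set
  x ~ y = adj G x y ≡ true

  _~?_ : ∀ x y → Dec (x ~ y)
  x ~? y = adj G x y ≟ᵇ true

  ~-sym : ∀ {x y} → x ~ y → y ~ x
  ~-sym {x} {y} = trans (sym G y x)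

  ~-irrefl : ∀ {x y} → x ≡ y → ¬ x ~ y
  ~-irrefl {x} refl x~x with trans (≡-sym x~x) (irrefl G x)
  ... | ()

  -- IPath P y x q: the list x ∷ q is an induced path ending at y, all of whose other vertices satisfy P.
  data IPath (P : Fin n → Set) (y : Fin n) : Fin n → List (Fin n) → Set where
    end  : IPath P y y []
    cons : ∀ {x z q} → P x → x ~ z → All (λ w → w ≢ x × ¬ x ~ w) q →
           IPath P y z q → IPath P y x (z ∷ q)

  module _ {P : Fin n → Set} {y : Fin n} where

    -- Attach x to the last vertex of the path that equals x or is adjacent to it.
    extend : ∀ {x z q} → P x → IPath P y z q → Any (λ w → x ≡ w ⊎ x ~ w) (z ∷ q) → ∃ (IPath P y x)
    extend {x} {q = q} px p near with anyˡ? (λ w → (x ≟ᶠ w) ⊎-dec (x ~? w)) q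
    extend px (cons _ _ _ p) near | yes near′ = extend px p near′
    extend px p (here (inj₁ refl)) | no _ = _ , p
    extend px p (here (inj₂ x~z)) | no far =
      _ , cons px x~z (All.map (λ ¬near → (¬near ∘ inj₁ ∘ ≡-sym) , (¬near ∘ inj₂)) (¬Any⇒All¬ _ far)) p
    extend px p (there near) | no far = contradiction near far

    inducedPath : ∀ {x} → Star (λ a b → P a × a ~ b) x y → ∃ (IPath P y x)
    inducedPath ε = _ , end
    inducedPath ((px , x~z) ◅ walk) = extend px (proj₂ (inducedPath walk)) (here (inj₂ x~z))

    path-vertices : ∀ {x q} → IPath P y x q → All (λ w → P w ⊎ w ≡ y) (x ∷ q)
    path-vertices end = inj₂ refl ∷ []
    path-vertices (cons px _ _ p) = inj₁ px ∷ path-vertices p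

    path-injective : ∀ {x q} → IPath P y x q → Injective _≡_ _≡_ (lookup (x ∷ q))
    path-injective p {zero} {zero} eq = refl
    path-injective (cons _ x~z far p) {zero} {suc zero} eq = contradiction x~z (~-irrefl eq)
    path-injective (cons _ x~z far p) {zero} {suc (suc j)} eq =
      contradiction (≡-sym eq) (proj₁ (All.lookup far (∈-lookup j)))
    path-injective (cons _ x~z far p) {suc zero} {zero} eq = contradiction x~z (~-irrefl (≡-sym eq))
    path-injective (cons _ x~z far p) {suc (suc i)} {zero} eq =
      contradiction eq (proj₁ (All.lookup far (∈-lookup i)))
    path-injective (cons _ _ _ p) {suc i} {suc j} eq = cong suc (path-injective p eq)

    path-adj : ∀ {x q} → IPath P y x q → ∀ i j →
      (lookup (x ∷ q) i ~ lookup (x ∷ q) j) ⇔′ (suc (toℕ i) ≡ toℕ j ⊎ suc (toℕ j) ≡ toℕ i)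
    path-adj p zero zero = (λ a → contradiction a (~-irrefl refl)) , λ { (inj₁ ()) ; (inj₂ ()) }
    path-adj (cons _ x~z far p) zero (suc zero) = (λ _ → inj₁ refl) , λ _ → x~z
    path-adj (cons _ x~z far p) zero (suc (suc j)) =
      (λ a → contradiction a (proj₂ (All.lookup far (∈-lookup j)))) , λ { (inj₁ ()) ; (inj₂ ()) }
    path-adj (cons _ x~z far p) (suc zero) zero = (λ _ → inj₂ refl) , λ _ → ~-sym x~z
    path-adj (cons _ x~z far p) (suc (suc i)) zero =
      (λ a → contradiction (~-sym a) (proj₂ (All.lookup far (∈-lookup i)))) , λ { (inj₁ ()) ; (inj₂ ()) }
    path-adj (cons _ _ _ p) (suc i) (suc j) with path-adj p i j
    ... | to , from = Sum.map (cong suc) (cong suc) ∘ to , from ∘ Sum.map suc-injective suc-injective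

    -- Every vertex of the path other than `y` satisfies `P`, so the only one that `v` can see is
    -- the last. The result is phrased by position because `CycAdj` compares indices.
    adj-only-end : ∀ {v x q} → v ~ y → All (λ w → P w → ¬ v ~ w) (x ∷ q) → IPath P y x q →
      ∀ j → (v ~ lookup (x ∷ q) j) ⇔′ (suc (toℕ j) ≡ length (x ∷ q))
    adj-only-end v~y _ end zero = (λ _ → refl) , λ _ → v~y
    adj-only-end v~y (¬v~x ∷ _) (cons px _ _ p) zero = (λ v~x → contradiction v~x (¬v~x px)) , λ ()
    adj-only-end v~y (_ ∷ ¬v~) (cons _ _ _ p) (suc j) with adj-only-end v~y ¬v~ p j
    ... | to , from = (λ a → cong suc (to a)) , λ e → from (suc-injective e)

    -- Prepending `v` closes the path into an induced cycle: by `avoid`, `v` is adjacent to no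
    -- vertex of the path but its two ends.
    path-to-hole : ∀ {v x q} → v ~ x → v ~ y → x ≢ y → ¬ x ~ y →
      (∀ {w} → P w → w ≢ v × (w ≢ x → ¬ v ~ w)) → IPath P y x q →
      ∃ λ S → IsHole G S × v ∈ S × x ∈ S × (∀ {z} → z ∈ S → z ≡ v ⊎ P z ⊎ z ≡ y)
    -- Distinct nonadjacent ends rule out paths on one or two vertices, so together with `v` the
    -- cycle has at least four.
    path-to-hole _ _ x≢y _ _ end = contradiction refl x≢y
    path-to-hole _ _ _ ¬x~y _ (cons _ x~y _ end) = contradiction x~y ¬x~y
    path-to-hole {v} {x} v~x v~y x≢y ¬x~y avoid p@(cons {q = _ ∷ r} px x~d far p′@(cons {x = d} {z = e} _ _ _ _)) =
      S , (length r , f , f-injective , f-adj , f-image) ,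
      ∈-comprehension⁺ image? (zero , refl) , ∈-comprehension⁺ image? (suc zero , refl) , S-vertices
      where
      l = length r

      f : Fin (4 + l) → Fin n
      f = lookup (v ∷ x ∷ d ∷ e ∷ r)

      image? : ∀ w → Dec (∃ λ i → f i ≡ w)
      image? w = any? (λ i → f i ≟ᶠ w)

      S = comprehension image?

      f-image : ∀ w → (w ∈ S) ⇔′ (∃ λ i → f i ≡ w)
      f-image w = ∈-comprehension⁻ image? , ∈-comprehension⁺ image?

      on-path : ∀ i → P (f (suc i)) ⊎ f (suc i) ≡ y
      on-path i = All.lookup (path-vertices p) (∈-lookup i)

      S-vertices : ∀ {z} → z ∈ S → z ≡ v ⊎ P z ⊎ z ≡ y
      S-vertices z∈S with ∈-comprehension⁻ image? z∈S
      ... | zero , refl = inj₁ refl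
      ... | suc i , refl = inj₂ (on-path i)

      off-v : ∀ i → f (suc i) ≢ v
      off-v i eq with on-path i
      ... | inj₁ pw = proj₁ (avoid pw) eq
      ... | inj₂ ≡y = ~-irrefl (trans (≡-sym eq) ≡y) v~y

      f-injective : Injective _≡_ _≡_ f
      f-injective {zero} {zero} eq = refl
      f-injective {zero} {suc j} eq = contradiction (≡-sym eq) (off-v j)
      f-injective {suc i} {zero} eq = contradiction eq (off-v i)
      f-injective {suc i} {suc j} eq = cong suc (path-injective p eq)

      -- `d` differs from `x` by adjacency and the later vertices by inducedness, so the exception
      -- for `x` in `avoid` never applies.
      tail-misses-v : All (λ w → P w → ¬ v ~ w) (d ∷ e ∷ r)
      tail-misses-v = (λ pd → proj₂ (avoid pd) (λ d≡x → ~-irrefl (≡-sym d≡x) x~d)) ∷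
                      All.map (λ (w≢x , _) pw → proj₂ (avoid pw) w≢x) far

      from-v : ∀ j → (v ~ f j) ⇔′ CycAdj l zero j
      from-v zero = (λ a → contradiction a (~-irrefl refl)) , λ { (inj₁ ()) ; (inj₂ ()) }
      from-v (suc zero) = (λ _ → inj₁ refl) , λ _ → v~x
      -- `v` has index `0`, so its edge to the last vertex `y` is exactly the wrap-around case.
      from-v (suc (suc j)) with adj-only-end v~y tail-misses-v p′ j | suc-mod {3 + l} (suc (suc j))
      ... | to , from | inj₁ (eq , mod≡0) =
        (λ _ → inj₂ mod≡0) , λ _ → from (suc-injective (suc-injective eq))
      ... | to , from | inj₂ (mod≡ , ≢) =
        (λ a → contradiction (cong (2 +_) (to a)) ≢) ,
        λ { (inj₁ ()) ; (inj₂ mod≡0) → contradiction (trans (≡-sym mod≡) mod≡0) λ () }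

      shift : ∀ (i j : Fin (3 + l)) → (suc (suc (toℕ i)) % (4 + l) ≡ suc (toℕ j)) ⇔′ (suc (toℕ i) ≡ toℕ j)
      shift i j with suc-mod {3 + l} (suc i)
      ... | inj₁ (eq , mod≡0) =
        (λ e → contradiction (trans (≡-sym mod≡0) e) λ ()) ,
        λ e → contradiction (trans (≡-sym (suc-injective eq)) e) λ e′ → <-irrefl (≡-sym e′) (toℕ<n j)
      ... | inj₂ (mod≡ , _) =
        (λ e → suc-injective (trans (≡-sym mod≡) e)) , λ e → trans mod≡ (cong suc e)

      f-adj : ∀ i j → (f i ~ f j) ⇔′ CycAdj l i j
      f-adj zero j = from-v j
      f-adj (suc i) zero with from-v (suc i)
      ... | to , from = Sum.swap ∘ to ∘ ~-sym , ~-sym ∘ from ∘ Sum.swap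
      f-adj (suc i) (suc j) with path-adj p i j
      ... | to , from = Sum.map (proj₂ (shift i j)) (proj₂ (shift j i)) ∘ to ,
                        from ∘ Sum.map (proj₁ (shift i j)) (proj₁ (shift j i))

  -- Existence of avoidable vertices

  HoleThrough : Subset n → Fin n → Fin n → Fin n → Set
  HoleThrough A v x y = ∃ λ S →
    IsHole G S × S ⊆ A × v ∈ S × x ∈ S × (∀ {z} → z ∈ S → v ~ z → z ≡ x ⊎ z ≡ y)

  Avoidable : Subset n → Fin n → Set
  Avoidable A v = ∀ {x y} → x ∈ A → y ∈ A → v ~ x → v ~ y → x ≢ y → ¬ x ~ y → HoleThrough A v x y

  -- A part R of A that can be searched on its own: the neighbours outside R of its
  -- vertices are joined to all of R and cause no obstruction to avoidability.
  Reduct : Subset n → Subset n → Set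
  Reduct A R = R ⊂ A × Nonempty R ×
    (∀ {v x} → v ∈ R → x ∈ A → x ∉ R → v ~ x →
      (∀ {r} → r ∈ R → x ~ r) ×
      (∀ {y} → y ∈ A → y ∉ R → v ~ y → x ≢ y → ¬ x ~ y → HoleThrough A v x y))

  module _ (A : Subset n) where

    Touches : Subset n → Fin n → Set
    Touches C z = ∃ λ c → c ∈ C × c ~ z

    touches? : ∀ C z → Dec (Touches C z)
    touches? C z = any? (λ c → (c ∈? C) ×-dec (c ~? z))

    beyond? : ∀ C z → Dec (z ∈ A × z ∉ C × ¬ Touches C z)
    beyond? C z = (z ∈? A) ×-dec ¬? (z ∈? C) ×-dec ¬? (touches? C z)

    beyond : Subset n → Subset n
    beyond C = comprehension (beyond? C)

    EdgeIn : Subset n → Fin n → Fin n → Set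
    EdgeIn C a b = a ∈ C × b ∈ C × a ~ b

    -- `x` and `y` both attach to the connected set `C`, in which `v` has no neighbour; an induced
    -- path between them through `C` therefore closes up at `v`.
    hole-via : ∀ {C c₀ v x y} → C ⊆ A → (∀ {a} → a ∈ C → Star (EdgeIn C) c₀ a) → v ∈ A → v ∉ C → ¬ Touches C v →
      x ∈ A → y ∈ A → Touches C x → Touches C y → v ~ x → v ~ y → x ≢ y → ¬ x ~ y → HoleThrough A v x y
    hole-via {C} {v = v} {x} {y} C⊆A conn v∈A v∉C ¬v x∈A y∈A (a , a∈C , a~x) (b , b∈C , b~y) v~x v~y x≢y ¬x~y
      with path-to-hole v~x v~y x≢y ¬x~y avoid (proj₂ (inducedPath walk))
      where
      P : Fin n → Set
      P z = z ∈ C ⊎ z ≡ x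
      -- `P` is asked of every vertex but the last, so `y` is exempt. The connections from `c₀` to
      -- `a` and to `b` are glued, the first one reversed.
      walk : Star (λ a b → P a × a ~ b) x y
      walk = (inj₂ refl , ~-sym a~x) ◅
             (Star.map (λ (p , _ , e) → inj₁ p , e)
               (Star.reverse (λ (p , q , e) → q , p , ~-sym e) (conn a∈C) ◅◅ conn b∈C)
             ◅◅ ((inj₁ b∈C , b~y) ◅ ε))
      avoid : ∀ {w} → P w → w ≢ v × (w ≢ x → ¬ v ~ w)
      avoid (inj₁ w∈C) = (λ { refl → v∉C w∈C }) , λ _ v~w → ¬v (_ , w∈C , ~-sym v~w)
      avoid (inj₂ refl) = (λ x≡v → ~-irrefl (≡-sym x≡v) v~x) , λ x≢x → contradiction refl x≢x
    ... | S , isHole , v∈S , x∈S , cover = S , isHole , S⊆A , v∈S , x∈S , nbrs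
      where
      S⊆A : S ⊆ A
      S⊆A z∈S with cover z∈S
      ... | inj₁ refl = v∈A
      ... | inj₂ (inj₁ (inj₁ z∈C)) = C⊆A z∈C
      ... | inj₂ (inj₁ (inj₂ refl)) = x∈A
      ... | inj₂ (inj₂ refl) = y∈A
      nbrs : ∀ {z} → z ∈ S → v ~ z → z ≡ x ⊎ z ≡ y
      nbrs z∈S v~z with cover z∈S
      ... | inj₁ refl = contradiction v~z (~-irrefl refl)
      ... | inj₂ (inj₁ (inj₁ z∈C)) = contradiction (_ , z∈C , ~-sym v~z) ¬v
      ... | inj₂ (inj₁ (inj₂ z≡x)) = inj₁ z≡x
      ... | inj₂ (inj₂ z≡y) = inj₂ z≡y

    -- Enlarge the connected set C as long as something lies beyond it; once C is maximal,
    -- every neighbour of C is adjacent to everything beyond C.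
    grow : ∀ C → Acc (λ p q → q ⊂ p) C → ∀ c₀ → c₀ ∈ C → C ⊆ A → (∀ {a} → a ∈ C → Star (EdgeIn C) c₀ a) →
      Nonempty (beyond C) → ∃ (Reduct A)
    grow C (acc rec) c₀ c₀∈C C⊆A conn nonempty
      with any? (λ w → ((w ∈? A) ×-dec ¬? (w ∈? C) ×-dec touches? C w) ×-dec
                       any? (λ r → (r ∈? beyond C) ×-dec ¬? (w ~? r)))
    ... | yes (w , (w∈A , w∉C , touch@(c , c∈C , c~w)) , r , r∈ , ¬w~r) =
      grow C′ (rec ((λ z∈ → C⊆C′ z∈) , w , w∈C′ , w∉C)) c₀ (C⊆C′ c₀∈C) C′⊆A conn′ (r , r∈′)
      where
      C′ = C ∪ ⁅ w ⁆
      C⊆C′ : C ⊆ C′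
      C⊆C′ z∈ = x∈p∪q⁺ (inj₁ z∈)
      w∈C′ : w ∈ C′
      w∈C′ = x∈p∪q⁺ (inj₂ (x∈⁅x⁆ w))
      split : ∀ {z} → z ∈ C′ → z ∈ C ⊎ z ≡ w
      split z∈ with x∈p∪q⁻ C ⁅ w ⁆ z∈
      ... | inj₁ z∈C = inj₁ z∈C
      ... | inj₂ z∈w = inj₂ (x∈⁅y⁆⇒x≡y w z∈w)
      C′⊆A : C′ ⊆ A
      C′⊆A z∈ with split z∈
      ... | inj₁ z∈C = C⊆A z∈C
      ... | inj₂ refl = w∈A
      weaken : ∀ {a} → a ∈ C → Star (EdgeIn C′) c₀ a
      weaken a∈C = Star.map (λ (p , q , e) → C⊆C′ p , C⊆C′ q , e) (conn a∈C)
      conn′ : ∀ {a} → a ∈ C′ → Star (EdgeIn C′) c₀ a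
      conn′ a∈ with split a∈
      ... | inj₁ a∈C = weaken a∈C
      ... | inj₂ refl = weaken c∈C ◅◅ ((C⊆C′ c∈C , w∈C′ , c~w) ◅ ε)
      -- `r` stays beyond: it is not adjacent to `w`, and it is not `w` itself, which touches `C`.
      r∈′ : r ∈ beyond C′
      r∈′ with ∈-comprehension⁻ (beyond? C) r∈
      ... | r∈A , r∉C , ¬r = ∈-comprehension⁺ (beyond? C′) (r∈A , r∉C′ , ¬touch)
        where
        r∉C′ : r ∉ C′
        r∉C′ r∈C′ with split r∈C′
        ... | inj₁ r∈C = r∉C r∈C
        ... | inj₂ refl = ¬r touch
        ¬touch : ¬ Touches C′ r
        ¬touch (d , d∈ , d~r) with split d∈
        ... | inj₁ d∈C = ¬r (d , d∈C , d~r)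
        ... | inj₂ refl = ¬w~r d~r
    ... | no maximal = beyond C , (beyond⊆A , c₀ , C⊆A c₀∈C , c₀∉) , nonempty , boundary
      where
      unfold : ∀ {z} → z ∈ beyond C → z ∈ A × z ∉ C × ¬ Touches C z
      unfold = ∈-comprehension⁻ (beyond? C)
      beyond⊆A : beyond C ⊆ A
      beyond⊆A z∈ = proj₁ (unfold z∈)
      c₀∉ : c₀ ∉ beyond C
      c₀∉ c₀∈ = proj₁ (proj₂ (unfold c₀∈)) c₀∈C
      -- `x` is not in `C`, since then `C` would touch `v`; were it untouched by `C`, it would
      -- itself lie beyond `C`.
      outside-touches : ∀ {v x} → v ∈ beyond C → x ∈ A → x ∉ beyond C → v ~ x → x ∉ C × Touches C x
      outside-touches {v} {x} v∈ x∈A x∉ v~x with unfold v∈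
      ... | _ , _ , ¬v = x∉C , decidable-stable (touches? C x) λ ¬x → x∉ (∈-comprehension⁺ (beyond? C) (x∈A , x∉C , ¬x))
        where
        x∉C : x ∉ C
        x∉C x∈C = ¬v (x , x∈C , ~-sym v~x)
      boundary : ∀ {v x} → v ∈ beyond C → x ∈ A → x ∉ beyond C → v ~ x →
        (∀ {r} → r ∈ beyond C → x ~ r) ×
        (∀ {y} → y ∈ A → y ∉ beyond C → v ~ y → x ≢ y → ¬ x ~ y → HoleThrough A v x y)
      boundary {v} {x} v∈ x∈A x∉ v~x with outside-touches v∈ x∈A x∉ v~x | unfold v∈
      ... | x∉C , touch-x | v∈A , v∉C , ¬v =
        (λ {r} r∈ → decidable-stable (x ~? r) λ ¬x~r → maximal (x , (x∈A , x∉C , touch-x) , r , r∈ , ¬x~r)) ,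
        λ y∈A y∉ v~y → hole-via C⊆A conn v∈A v∉C ¬v x∈A y∈A touch-x
                         (proj₂ (outside-touches v∈ y∈A y∉ v~y)) v~x v~y

    -- In a clique avoidability is vacuous. Otherwise two nonadjacent vertices `c` and `d` start the
    -- growth at `⁅ c ⁆`, with `d` beyond it.
    clique-or-reduct : (∀ {v} → v ∈ A → Avoidable A v) ⊎ ∃ (Reduct A)
    clique-or-reduct
      with any? (λ c → (c ∈? A) ×-dec any? (λ d → (d ∈? A) ×-dec ¬? (c ≟ᶠ d) ×-dec ¬? (c ~? d)))
    ... | no clique = inj₁ λ _ x∈A y∈A _ _ x≢y ¬x~y → contradiction (_ , x∈A , _ , y∈A , x≢y , ¬x~y) clique
    ... | yes (c , c∈A , d , d∈A , c≢d , ¬c~d) =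
      inj₂ (grow ⁅ c ⁆ (⊃-wellFounded _) c (x∈⁅x⁆ c) c⊆A conn
             (d , ∈-comprehension⁺ (beyond? ⁅ c ⁆) (d∈A , (λ d∈ → c≢d (≡-sym (x∈⁅y⁆⇒x≡y c d∈))) , ¬touch)))
      where
      c⊆A : ⁅ c ⁆ ⊆ A
      c⊆A z∈ with x∈⁅y⁆⇒x≡y c z∈
      ... | refl = c∈A
      conn : ∀ {a} → a ∈ ⁅ c ⁆ → Star (EdgeIn ⁅ c ⁆) c a
      conn a∈ with x∈⁅y⁆⇒x≡y c a∈
      ... | refl = ε
      ¬touch : ¬ Touches ⁅ c ⁆ d
      ¬touch (e , e∈ , e~d) with x∈⁅y⁆⇒x≡y c e∈
      ... | refl = ¬c~d e~d

  -- For `x` and `y` both in `R`, avoidability in `R` applies; for both outside, `boundary` supplies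
  -- the hole; a mixed pair would be adjacent, as the outer vertex is joined to all of `R`.
  avoidable-lift : ∀ {A R} → Reduct A R → ∀ {v} → v ∈ R → Avoidable R v → Avoidable A v
  avoidable-lift {A} {R} ((R⊆A , _) , _ , boundary) {v} v∈R avoidable {x} {y} x∈A y∈A v~x v~y x≢y ¬x~y
    with x ∈? R | y ∈? R
  ... | yes x∈R | yes y∈R with avoidable x∈R y∈R v~x v~y x≢y ¬x~y
  ...   | S , isHole , S⊆R , rest = S , isHole , (λ z∈ → R⊆A (S⊆R z∈)) , rest
  avoidable-lift (_ , _ , boundary) v∈R _ x∈A y∈A v~x v~y x≢y ¬x~y
      | no x∉R | yes y∈R = contradiction (proj₁ (boundary v∈R x∈A x∉R v~x) y∈R) ¬x~y
  avoidable-lift (_ , _ , boundary) v∈R _ x∈A y∈A v~x v~y x≢y ¬x~y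
      | yes x∈R | no y∉R = contradiction (~-sym (proj₁ (boundary v∈R y∈A y∉R v~y) x∈R)) ¬x~y
  avoidable-lift (_ , _ , boundary) v∈R _ x∈A y∈A v~x v~y x≢y ¬x~y
      | no x∉R | no y∉R = proj₂ (boundary v∈R x∈A x∉R v~x) y∈A y∉R v~y x≢y ¬x~y

  avoidable-vertex : ∀ A → Acc _⊂_ A → Nonempty A → ∃ λ v → v ∈ A × Avoidable A v
  avoidable-vertex A (acc rec) (a , a∈A) with clique-or-reduct A
  ... | inj₁ all-avoidable = a , a∈A , all-avoidable a∈A
  ... | inj₂ (R , reduct@(R⊂A , nonempty , _)) with avoidable-vertex R (rec R⊂A) nonempty
  ...   | v , v∈R , avoidable = v , proj₁ R⊂A v∈R , avoidable-lift reduct v∈R avoidable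

  -- Covering edges by cliques with spare prey

  module _ {k : ℕ} where

    Sink : Set
    Sink = Fin n ⊎ Fin k

    Alive : Subset n → Sink → Set
    Alive A (inj₁ a) = a ∈ A
    Alive A (inj₂ _) = ⊥

    Fresh : Subset n → List Sink → Set
    Fresh A T = Unique T × All (λ t → ¬ Alive A t) T

    -- T lists the spare prey: deleted vertices and new isolated ones that may still receive
    -- arcs.  X singles out the edges not already accounted for by cliques fixed earlier.
    record Realisation (A : Subset n) (T : List Sink) (X : Fin n → Fin n → Set) : Set where
      field
        arcs     : Fin n → Sink → Bool
        rank     : Fin n → ℕ
        tail∈    : ∀ {u t} → arcs u t ≡ true → u ∈ A
        head∈    : ∀ {u t} → arcs u t ≡ true → t ∈ˡ T ⊎ Alive A t
        sound    : ∀ {u w t} → arcs u t ≡ true → arcs w t ≡ true → u ≢ w → u ~ w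
        complete : ∀ {u w} → X u w → u ∈ A → w ∈ A → u ~ w → ∃ λ t → arcs u t ≡ true × arcs w t ≡ true
        rank<    : ∀ {u w} → arcs u (inj₁ w) ≡ true → rank w < rank u
        rank-out : ∀ {a} → a ∉ A → rank a ≡ 0
        rank-in  : ∀ {a} → a ∈ A → 0 < rank a

    open Realisation

    infix 4 _≟ˢ_
    _≟ˢ_ : (s t : Sink) → Dec (s ≡ t)
    _≟ˢ_ = ≡-dec-⊎ _≟ᶠ_ _≟ᶠ_

    realise-empty : ∀ {A T X} → ¬ Nonempty A → Realisation A T X
    realise-empty empty = record
      { arcs     = λ _ _ → false
      ; rank     = λ _ → 0
      ; tail∈    = λ ()
      ; head∈    = λ ()
      ; sound    = λ ()
      ; complete = λ _ u∈A → contradiction (_ , u∈A) empty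
      ; rank<    = λ ()
      ; rank-out = λ _ → refl
      ; rank-in  = λ a∈A → contradiction (_ , a∈A) empty
      }

    Clique : Subset n → Set
    Clique K = ∀ {u w} → u ∈ K → w ∈ K → u ≢ w → u ~ w

    -- All of `K` receives the common prey `t`, which accounts for the edges inside `K`; the given
    -- realisation handles the rest of `X`.
    realise-clique : ∀ {A t T X} (K : Subset n) → Fresh A (t ∷ T) → K ⊆ A → Clique K →
      Realisation A T (λ u w → X u w × ¬ (u ∈ K × w ∈ K)) → Realisation A (t ∷ T) X
    realise-clique {A} {t} {T} {X} K (t∉T ∷ _ , t∉A ∷ _) K⊆A clique D = record
      { arcs     = arcs′
      ; rank     = rank D
      ; tail∈    = λ {u} {s} → tail∈′ u s
      ; head∈    = λ {u} {s} → head∈′ u s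
      ; sound    = λ {u} {w} {s} → sound′ u w s
      ; complete = complete′
      ; rank<    = λ {u} {w} → rank<′ u w
      ; rank-out = rank-out D
      ; rank-in  = rank-in D
      }
      where
      arcs′ : Fin n → Sink → Bool
      arcs′ u s with s ≟ˢ t
      ... | yes _ = does (u ∈? K)
      ... | no  _ = arcs D u s

      tail∈′ : ∀ u s → arcs′ u s ≡ true → u ∈ A
      tail∈′ u s e with s ≟ˢ t
      ... | yes _ = K⊆A (does-true (u ∈? K) e)
      ... | no  _ = tail∈ D e

      head∈′ : ∀ u s → arcs′ u s ≡ true → s ∈ˡ t ∷ T ⊎ Alive A s
      head∈′ u s e with s ≟ˢ t
      ... | yes s≡t = inj₁ (here s≡t)
      ... | no  _ = Sum.map₁ there (head∈ D e)

      sound′ : ∀ u w s → arcs′ u s ≡ true → arcs′ w s ≡ true → u ≢ w → u ~ w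
      sound′ u w s e e′ with s ≟ˢ t
      ... | yes _ = clique (does-true (u ∈? K) e) (does-true (w ∈? K) e′)
      ... | no  _ = sound D e e′

      arcs′-t : ∀ {u} → u ∈ K → arcs′ u t ≡ true
      arcs′-t {u} u∈K with t ≟ˢ t
      ... | yes _ = dec-true (u ∈? K) u∈K
      ... | no t≢t = contradiction refl t≢t

      -- Overwriting the arcs into `t` loses nothing: the prey in `D` are members of `T` or alive,
      -- and `t` is neither.
      arcs′-old : ∀ {u s} → arcs D u s ≡ true → arcs′ u s ≡ true
      arcs′-old {u} {s} e with s ≟ˢ t
      ... | no _ = e
      ... | yes refl with head∈ D e
      ...   | inj₁ t∈T = contradiction refl (All.lookup t∉T t∈T)
      ...   | inj₂ t∈A = contradiction t∈A t∉A

      complete′ : ∀ {u w} → X u w → u ∈ A → w ∈ A → u ~ w → ∃ λ s → arcs′ u s ≡ true × arcs′ w s ≡ true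
      complete′ {u} {w} xuw u∈A w∈A u~w with (u ∈? K) ×-dec (w ∈? K)
      ... | yes (u∈K , w∈K) = t , arcs′-t u∈K , arcs′-t w∈K
      ... | no ¬K with complete D (xuw , ¬K) u∈A w∈A u~w
      ...   | s , e , e′ = s , arcs′-old e , arcs′-old e′

      rank<′ : ∀ u w → arcs′ u (inj₁ w) ≡ true → rank D w < rank D u
      rank<′ u w e with inj₁ w ≟ˢ t
      -- `t` is dead, hence of rank `0`, while members of `K` have positive rank.
      ... | yes refl = subst (_< rank D u) (≡-sym (rank-out D t∉A)) (rank-in D (K⊆A (does-true (u ∈? K) e)))
      ... | no  _ = rank< D e

    -- With no edge of `X` at `v`, a realisation of `A - v` accounts for all of `X`. There `v` is
    -- dead and may serve as prey; in `A` it is alive again.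
    realise-vertex : ∀ {A T v X} → v ∈ A → (∀ {u w} → X u w → w ∈ A → u ~ w → u ≢ v) → (∀ {u w} → X u w → X w u) →
      Realisation (A - v) (inj₁ v ∷ T) (λ _ _ → ⊤) → Realisation A T X
    realise-vertex {A} {T} {v} {X} v∈A isolated X-sym D = record
      { arcs     = arcs D
      ; rank     = rank′
      ; tail∈    = λ e → A-v⊆A (tail∈ D e)
      ; head∈    = head∈′
      ; sound    = sound D
      ; complete = λ xuw u∈A w∈A u~w → complete D tt
          (x∈p∧x≢y⇒x∈p-y u∈A (isolated xuw w∈A u~w))
          (x∈p∧x≢y⇒x∈p-y w∈A (isolated (X-sym xuw) u∈A (~-sym u~w))) u~w
      ; rank<    = rank<′
      ; rank-out = rank-out′
      ; rank-in  = rank-in′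
      }
      where
      A-v⊆A : A - v ⊆ A
      A-v⊆A = p─q⊆p A ⁅ v ⁆

      -- Raising ranks on `A` by one gives `v`, of rank `0` in `D`, the positive rank of a live
      -- vertex and preserves the order.
      rank′ : Fin n → ℕ
      rank′ a with a ∈? A
      ... | yes _ = suc (rank D a)
      ... | no  _ = 0

      rank-in′ : ∀ {a} → a ∈ A → 0 < rank′ a
      rank-in′ {a} a∈A with a ∈? A
      ... | yes _ = z<s
      ... | no a∉A = contradiction a∈A a∉A

      rank-out′ : ∀ {a} → a ∉ A → rank′ a ≡ 0
      rank-out′ {a} a∉A with a ∈? A
      ... | yes a∈A = contradiction a∈A a∉A
      ... | no _ = refl

      head∈′ : ∀ {u t} → arcs D u t ≡ true → t ∈ˡ T ⊎ Alive A t
      head∈′ {t = t} e with head∈ D e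
      ... | inj₁ (here refl) = inj₂ v∈A
      ... | inj₁ (there t∈T) = inj₁ t∈T
      head∈′ {t = inj₁ _} e | inj₂ t∈ = inj₂ (A-v⊆A t∈)

      rank<′ : ∀ {u w} → arcs D u (inj₁ w) ≡ true → rank′ w < rank′ u
      rank<′ {u} {w} e with u ∈? A | w ∈? A
      ... | yes _ | yes _ = s<s (rank< D e)
      ... | yes _ | no _ = z<s
      ... | no u∉A | _ = contradiction (A-v⊆A (tail∈ D e)) u∉A

    -- Removing an avoidable vertex

    module Elimination {A : Subset n} {v : Fin n} (v∈A : v ∈ A) where

      Chosen : Subset n → Fin n → Set
      Chosen S z = z ∈ A × z ∈ S × v ~ z

      chosen? : ∀ S → Dec (∃ (Chosen S))
      chosen? S = any? (λ z → (z ∈? A) ×-dec (z ∈? S) ×-dec (v ~? z))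

      -- Always a clique, so that one prey can be spent on every list entry, hole or not; the
      -- singleton covers no edge.
      star : Subset n → Subset n
      star S with chosen? S
      ... | yes (z , _) = ⁅ v ⁆ ∪ ⁅ z ⁆
      ... | no _ = ⁅ v ⁆

      v∈star : ∀ S → v ∈ star S
      v∈star S with chosen? S
      ... | yes (z , _) = x∈p∪q⁺ (inj₁ (x∈⁅x⁆ v))
      ... | no _ = x∈⁅x⁆ v

      chosen∈star : ∀ {S x} → Chosen S x → ∃ λ z → Chosen S z × z ∈ star S
      chosen∈star {S} chosen with chosen? S
      ... | yes (z , cz) = z , cz , x∈p∪q⁺ (inj₂ (x∈⁅x⁆ z))
      ... | no none = contradiction (_ , chosen) none

      star⊆A : ∀ S → star S ⊆ A
      star⊆A S u∈ with chosen? S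
      star⊆A S u∈ | no _ with refl ← x∈⁅y⁆⇒x≡y v u∈ = v∈A
      star⊆A S u∈ | yes (z , z∈A , _) with x∈p∪q⁻ ⁅ v ⁆ ⁅ z ⁆ u∈
      ... | inj₁ u∈v with refl ← x∈⁅y⁆⇒x≡y v u∈v = v∈A
      ... | inj₂ u∈z with refl ← x∈⁅y⁆⇒x≡y z u∈z = z∈A

      star-clique : ∀ S → Clique (star S)
      star-clique S u∈ w∈ u≢w with chosen? S
      ... | no _ = contradiction (trans (x∈⁅y⁆⇒x≡y v u∈) (≡-sym (x∈⁅y⁆⇒x≡y v w∈))) u≢w
      ... | yes (z , _ , _ , v~z) with x∈p∪q⁻ ⁅ v ⁆ ⁅ z ⁆ u∈ | x∈p∪q⁻ ⁅ v ⁆ ⁅ z ⁆ w∈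
      ...   | inj₁ u∈v | inj₁ w∈v = contradiction (trans (x∈⁅y⁆⇒x≡y v u∈v) (≡-sym (x∈⁅y⁆⇒x≡y v w∈v))) u≢w
      ...   | inj₂ u∈z | inj₂ w∈z = contradiction (trans (x∈⁅y⁆⇒x≡y z u∈z) (≡-sym (x∈⁅y⁆⇒x≡y z w∈z))) u≢w
      ...   | inj₁ u∈v | inj₂ w∈z with refl ← x∈⁅y⁆⇒x≡y v u∈v | refl ← x∈⁅y⁆⇒x≡y z w∈z = v~z
      ...   | inj₂ u∈z | inj₁ w∈v with refl ← x∈⁅y⁆⇒x≡y z u∈z | refl ← x∈⁅y⁆⇒x≡y v w∈v = ~-sym v~z

      Unstarred : List (Subset n) → Fin n → Fin n → Set
      Unstarred L u w = All (λ S → ¬ (u ∈ star S × w ∈ star S)) L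

      -- Each star consumes one prey and its edge is excluded from then on; the continuation `rest`
      -- receives the `m` prey left over.
      realise-stars : ∀ L {m} T X → length T ≡ length L + m → Fresh A T →
        (∀ T′ → length T′ ≡ m → Fresh A T′ → Realisation A T′ (λ u w → X u w × Unstarred L u w)) → Realisation A T X
      realise-stars [] T X len fresh rest = record { Realisation D ; complete = λ xuw → complete D (xuw , []) }
        where D = rest T len fresh
      realise-stars (S ∷ L) (t ∷ T) X len fresh@(_ ∷ unique , _ ∷ dead) rest =
        realise-clique (star S) fresh (star⊆A S) (star-clique S)
          (realise-stars L T _ (suc-injective len) (unique , dead) λ T′ len′ fresh′ →
            let D = rest T′ len′ fresh′ in
            record { Realisation D ; complete = λ ((xuw , ¬S) , ¬L) → complete D (xuw , ¬S ∷ ¬L) })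

      Remaining : List (Subset n) → Fin n → Set
      Remaining L z = z ≡ v ⊎ (z ∈ A × v ~ z × All (λ S → z ∉ star S) L)

      remaining? : ∀ L z → Dec (Remaining L z)
      remaining? L z = (z ≟ᶠ v) ⊎-dec ((z ∈? A) ×-dec (v ~? z) ×-dec All.all? (λ S → ¬? (z ∈? star S)) L)

      -- Nonadjacent `x` and `y` would lie on a hole of `L` on which `v` has no other neighbours;
      -- the neighbour chosen there is one of them, hence starred.
      remaining-clique : Avoidable A v → ∀ {L} → (∀ {S} → IsHole G S → S ⊆ A → v ∈ S → S ∈ˡ L) →
        ∀ {x y} → Remaining L x → Remaining L y → x ≢ y → x ~ y
      remaining-clique _ _ (inj₁ refl) (inj₁ refl) x≢y = contradiction refl x≢y
      remaining-clique _ _ (inj₁ refl) (inj₂ (_ , v~y , _)) _ = v~y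
      remaining-clique _ _ (inj₂ (_ , v~x , _)) (inj₁ refl) _ = ~-sym v~x
      remaining-clique avoidable holes {x} {y} (inj₂ (x∈A , v~x , ¬x)) (inj₂ (y∈A , v~y , ¬y)) x≢y =
        decidable-stable (x ~? y) λ ¬x~y → absurd (avoidable x∈A y∈A v~x v~y x≢y ¬x~y)
        where
        absurd : ¬ HoleThrough A v x y
        absurd (S , isHole , S⊆A , v∈S , x∈S , nbrs) with chosen∈star {S} (x∈A , x∈S , v~x)
        ... | z , (_ , z∈S , v~z) , z∈star with nbrs z∈S v~z
        ...   | inj₁ refl = All.lookup ¬x (holes isHole S⊆A v∈S) z∈star
        ...   | inj₂ refl = All.lookup ¬y (holes isHole S⊆A v∈S) z∈star

      -- The stars use `length L` prey, `K` uses one and the deletion returns `v`, so `suc m` prey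
      -- remain for `A - v`.
      eliminate : Avoidable A v → ∀ L {m} T → length T ≡ length L + suc m → Fresh A T →
        (∀ {S} → IsHole G S → S ⊆ A → v ∈ S → S ∈ˡ L) →
        (∀ T′ → length T′ ≡ suc m → Fresh (A - v) T′ → Realisation (A - v) T′ (λ _ _ → ⊤)) →
        Realisation A T (λ _ _ → ⊤)
      eliminate avoidable L T len fresh holes rest = realise-stars L T _ len fresh finish
        where
        K = comprehension (remaining? L)
        K⁻ : ∀ {z} → z ∈ K → Remaining L z
        K⁻ = ∈-comprehension⁻ (remaining? L)
        K⊆A : K ⊆ A
        K⊆A z∈K with K⁻ z∈K
        ... | inj₁ refl = v∈A
        ... | inj₂ (z∈A , _) = z∈A

        finish : ∀ T′ → length T′ ≡ suc _ → Fresh A T′ → Realisation A T′ (λ u w → ⊤ × Unstarred L u w)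
        finish (t ∷ T′) len′ fresh′@(_ ∷ unique , _ ∷ dead) =
          realise-clique K fresh′ K⊆A (λ x∈K y∈K → remaining-clique avoidable holes (K⁻ x∈K) (K⁻ y∈K))
            (realise-vertex v∈A isolated
              (λ ((_ , ¬L) , ¬K) → (tt , All.map (_∘ swap) ¬L) , ¬K ∘ swap)
              (rest (inj₁ v ∷ T′) len′ (v-new ∷ unique , v-dead ∷ All.map (λ {t} → still-dead t) dead)))
          where
          v-new : All (inj₁ v ≢_) T′
          v-new = All.map (λ { ¬alive refl → ¬alive v∈A }) dead
          v-dead : v ∉ A - v
          v-dead v∈ = x∈p-y⇒x≢y v∈ refl
          still-dead : ∀ t → ¬ Alive A t → ¬ Alive (A - v) t
          still-dead (inj₁ a) ¬a a∈ = ¬a (p─q⊆p A ⁅ v ⁆ a∈)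
          still-dead (inj₂ _) _ ()
          -- A neighbour of `v` in `A` is either starred or in `K`, so every edge at `v` is already
          -- covered.
          isolated : ∀ {u w} → (⊤ × Unstarred L u w) × ¬ (u ∈ K × w ∈ K) → w ∈ A → u ~ w → u ≢ v
          isolated ((_ , ¬L) , ¬K) w∈A v~w refl = ¬K
            ( ∈-comprehension⁺ (remaining? L) (inj₁ refl)
            , ∈-comprehension⁺ (remaining? L) (inj₂ (w∈A , v~w , All.map (λ {S} ¬S w∈ → ¬S (v∈star S , w∈)) ¬L)))

    -- The induction and the resulting digraph

    realise : ∀ A → Acc _⊂_ A → ∀ L T → length T ≡ suc (length L) → Fresh A T →
      (∀ {S} → IsHole G S → S ⊆ A → S ∈ˡ L) → Realisation A T (λ _ _ → ⊤)
    realise A (acc rec) L T len fresh holes with nonempty? A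
    ... | no empty = realise-empty empty
    ... | yes nonempty with avoidable-vertex A (⊂-wellFounded A) nonempty
    ...   | v , v∈A , avoidable = eliminate v∈A avoidable (filter (v ∈?_) L) T
              -- `m` counts the entries of `L` that miss `v`, so the invariant of one more prey than
              -- entries passes to `A - v`.
              (trans len (trans (cong suc (≡-sym (length-filter-∁ (v ∈?_) L))) (≡-sym (+-suc _ _))))
              fresh
              (λ isHole S⊆A v∈S → ∈-filter⁺ (v ∈?_) (holes isHole S⊆A) v∈S)
              (λ T′ len′ fresh′ → realise (A - v) (rec (x∈p⇒p-x⊂p v∈A)) (filter (¬? ∘ (v ∈?_)) L) T′ len′ fresh′
                λ isHole S⊆ → ∈-filter⁺ (¬? ∘ (v ∈?_)) (holes isHole (λ z∈ → p─q⊆p A ⁅ v ⁆ (S⊆ z∈)))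
                                (λ v∈S → x∈p-y⇒x≢y (S⊆ v∈S) refl))
      where open Elimination

    -- Ranks strictly decrease along arcs, which excludes directed cycles; `sound` and `complete`
    -- match common prey with adjacency.
    realisation⇒competition : ∀ {T} → Realisation full T (λ _ _ → ⊤) → CompetitionWith G k
    realisation⇒competition D = D⁺ , acyclic , competition
      where
      arc⁺ : Sink → Sink → Bool
      arc⁺ (inj₁ a) t = arcs D a t
      arc⁺ (inj₂ _) _ = false

      D⁺ : Digraph (n + k)
      D⁺ = record { arc = λ x y → arc⁺ (splitAt n x) (splitAt n y) }

      -- New vertices send no arcs and take the bottom rank; the shift by one puts every old vertex
      -- above them.
      rank⁺ : Sink → ℕ
      rank⁺ (inj₁ a) = suc (rank D a)
      rank⁺ (inj₂ _) = 0

      arc-rank : ∀ s t → arc⁺ s t ≡ true → rank⁺ t < rank⁺ s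
      arc-rank (inj₁ _) (inj₁ _) e = s<s (rank< D e)
      arc-rank (inj₁ _) (inj₂ _) e = z<s

      path-rank : ∀ {x y} → Path⁺ D⁺ x y → rank⁺ (splitAt n y) < rank⁺ (splitAt n x)
      path-rank (step {x} {y} e) = arc-rank (splitAt n x) (splitAt n y) e
      path-rank (cons {x} {y} e p) = <-trans (path-rank p) (arc-rank (splitAt n x) (splitAt n y) e)

      acyclic : Acyclic D⁺
      acyclic v p = <-irrefl refl (path-rank p)

      splitAt-injective : ∀ {x y} → splitAt n {k} x ≡ splitAt n y → x ≡ y
      splitAt-injective {x} {y} e = trans (≡-sym (join-splitAt n k x)) (trans (cong (join n k) e) (join-splitAt n k y))

      competition : IsCompetitionGraphOf (addIsolated G k) D⁺
      competition x y x≢y with splitAt n x in eqx | splitAt n y in eqy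
      ... | inj₁ a | inj₁ b = to , from
        where
        to : a ~ b → ∃ λ v → arcs D a (splitAt n v) ≡ true × arcs D b (splitAt n v) ≡ true
        to a~b with complete D tt ∈⊤ ∈⊤ a~b
        ... | t , e , e′ = join n k t , trans (cong (arcs D a) (splitAt-join n k t)) e
                                      , trans (cong (arcs D b) (splitAt-join n k t)) e′
        from : (∃ λ v → arcs D a (splitAt n v) ≡ true × arcs D b (splitAt n v) ≡ true) → a ~ b
        from (v , e , e′) = sound D e e′ λ { refl → x≢y (splitAt-injective (trans eqx (≡-sym eqy))) }
      ... | inj₁ a | inj₂ _ = (λ ()) , λ ()
      ... | inj₂ _ | _ = (λ ()) , λ ()

  -- Initially the spare prey are exactly the new isolated vertices, one more than `L` has entries.
  competition-by-holes : ∀ L → (∀ {S} → IsHole G S → S ∈ˡ L) → CompetitionWith G (suc (length L))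
  competition-by-holes L holes = realisation⇒competition
    (realise full (⊂-wellFounded full) L T
      (trans (length-map inj₂ (allFin (suc (length L)))) (length-tabulate {n = suc (length L)} id))
      (Unique-map⁺ inj₂-injective (allFin⁺ _) , All-map⁺ (All.universal (λ _ ()) _))
      (λ isHole _ → holes isHole))
    where
    T : List (Fin n ⊎ Fin (suc (length L)))
    T = map inj₂ (allFin _)

theorem4 : ∀ (n : ℕ) (G : Graph n) → ExactlyTwoHoles G → CompetitionNumber≤ G 3
theorem4 n G (S₁ , S₂ , _ , _ , _ , only) =
  -- The witness `3` is one plus the two listed holes.
  3 , ≤-refl , competition-by-holes G (S₁ ∷ S₂ ∷ []) λ isHole → listed (only _ isHole)
  where
  listed : ∀ {S} → S ≡ S₁ ⊎ S ≡ S₂ → S ∈ˡ S₁ ∷ S₂ ∷ []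
  listed (inj₁ eq) = here eq
  listed (inj₂ eq) = there (here eq)
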